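{- Let $n\in\mathbb{N}$, $n>1$, and let $h_1,h_2\in\mathcal{I}$. Suppose there is a permutation $\nu$ of the set $h_1(D_n)$, restricting to a permutation of the set $h_1(P^*_n)$, such that $h_2(x)=\nu(h_1(x))$ for all $x\in D_n$. Then $$\mathbb{Z}/\!\sim_{\preceq_{d^{(n)}_{(h_1,+)}}}\;=\;\mathbb{Z}/\!\sim_{\preceq_{d^{(n)}_{(h_2,+)}}}.$$
   Context: $\mathbb{N}$ is the set of positive integers, $D_n=\{x\in\mathbb{N}: x\mid n\}$, and $P^*_n$ is the set of prime powers $p^i$ ($p$ prime, $i\ge1$) dividing $n$. A function $h:\mathbb{N}\to\mathbb{R}$ is multiplicative if $h$ is not identically zero and $h(xy)=h(x)h(y)$ for all coprime $x,y\in\mathbb{N}$. $\mathcal{I}$ is the set of multiplicative $h$ with $0\le h(x)\le1$ for all $x>1$. For $h\in\mathcal{I}$ and $x,y\in\mathbb{Z}$, $d^{(n)}_{(h,+)}(x,y)=0$ if $x=y$ and $d^{(n)}_{(h,+)}(x,y)=2-h(\gcd(x,n))-h(\gcd(y,n))$ if $x\neq y$; this is a pseudometric on $\mathbb{Z}$. For a pseudometric $d$ on $\mathbb{Z}$, $x\preceq_d y\iff d(1,x)\le d(1,y)$, and $x\sim_{\preceq_d}y\iff(x\preceq_d y\text{ and }y\preceq_d x)$. $\mathbb{Z}/\!\sim$ denotes the set of equivalence classes. -}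

module Defs where

open import Data.Nat.Base as ℕ using (ℕ; NonZero)
import Data.Nat.Properties as ℕ
open import Data.Nat.Coprimality using (Coprime)
open import Data.Nat.Divisibility using (_∣_)
open import Data.Nat.GCD using (gcd; gcd[m,n]≢0)
open import Data.Nat.Primality using (Prime)
open import Data.Integer.Base as ℤ using (ℤ; 1ℤ)
import Data.Integer.Properties as ℤ
open import Data.Rational.Base as ℚ using (ℚ; 0ℚ; 1ℚ; ½; ∣_∣)
import Data.Rational.Properties as ℚ
open import Data.Rational.Solver using (module +-*-Solver)
open import Data.Bool.Base using (if_then_else_)
open import Data.Product.Base using (Σ-syntax; ∃; ∃-syntax; _×_; _,_; proj₁; proj₂)
open import Data.Sum.Base using (inj₂)
open import Function.Bundles using (Bijection)
open import Level using (0ℓ)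
open import Relation.Binary.Bundles using (Setoid)
open import Relation.Binary.Core using (Rel)
import Relation.Binary.Construct.On as On
open import Relation.Binary.PropositionalEquality
  using (_≡_; refl; sym; trans; cong; subst)
open import Relation.Nullary using (¬_; does)
open import Relation.Unary using (Pred; _⊆_; _≐_)

------------------------------------------------------------------------
-- Real numbers: Cauchy sequences of rationals, with two sequences
-- identified (by the setoid equality _≈_) when their difference is null.

Eventually : Pred ℕ 0ℓ → Set
Eventually P = ∃[ N ] (∀ n → N ℕ.≤ n → P n)

Cauchy : Pred (ℕ → ℚ) 0ℓ
Cauchy a = ∀ ε → 0ℚ ℚ.< ε →
           ∃[ N ] (∀ m n → N ℕ.≤ m → N ℕ.≤ n → ∣ a m ℚ.- a n ∣ ℚ.< ε)

record ℝ : Set where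
  constructor mkℝ
  field
    seq    : ℕ → ℚ
    cauchy : Cauchy seq

open ℝ public

infix 4 _≈_ _≤_

record _≈_ (x y : ℝ) : Set where
  constructor mk≈
  field
    close : ∀ ε → 0ℚ ℚ.< ε → Eventually (λ n → ∣ seq x n ℚ.- seq y n ∣ ℚ.< ε)

record _≤_ (x y : ℝ) : Set where
  constructor mk≤
  field
    below : ∀ ε → 0ℚ ℚ.< ε → Eventually (λ n → seq x n ℚ.< seq y n ℚ.+ ε)

open _≈_ public
open _≤_ public

-- The proofs are abstract so that they are never unfolded; the sequences
-- underlying the operations below do compute.
abstract
  private
    half>0 : ∀ {ε} → 0ℚ ℚ.< ε → 0ℚ ℚ.< ½ ℚ.* ε
    half>0 {ε} ε>0 =
      ℚ.positive⁻¹ _ {{ℚ.pos*pos⇒pos ½ ε {{ℚ.positive ε>0}}}}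

    half+half : ∀ ε → ½ ℚ.* ε ℚ.+ ½ ℚ.* ε ≡ ε
    half+half ε = trans (sym (ℚ.*-distribʳ-+ ε ½ ½)) (ℚ.*-identityˡ ε)

    split : ∀ {ε p q} r → r ≡ p ℚ.+ q →
            ∣ p ∣ ℚ.< ½ ℚ.* ε → ∣ q ∣ ℚ.< ½ ℚ.* ε → ∣ r ∣ ℚ.< ε
    split {ε} {p} {q} r refl p< q< =
      ℚ.≤-<-trans (ℚ.∣p+q∣≤∣p∣+∣q∣ p q)
        (subst (_ ℚ.<_) (half+half ε) (ℚ.+-mono-< p< q<))

    ∣-∣-comm : ∀ p q → ∣ p ℚ.- q ∣ ≡ ∣ q ℚ.- p ∣
    ∣-∣-comm p q = trans (cong ∣_∣ eq) (ℚ.∣-p∣≡∣p∣ (q ℚ.- p))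
      where
      open +-*-Solver
      eq : p ℚ.- q ≡ ℚ.- (q ℚ.- p)
      eq = solve 2 (λ p q → p :- q := :- (q :- p)) refl p q

    ∣p-p∣<ε : ∀ p {ε} → 0ℚ ℚ.< ε → ∣ p ℚ.- p ∣ ℚ.< ε
    ∣p-p∣<ε p {ε} = subst (ℚ._< ε) (cong ∣_∣ (sym (ℚ.+-inverseʳ p)))

  ≈-refl : ∀ {x} → x ≈ x
  ≈-refl {x} = mk≈ λ ε ε>0 → 0 , λ n _ → ∣p-p∣<ε (seq x n) ε>0

  ≈-sym : ∀ {x y} → x ≈ y → y ≈ x
  ≈-sym {x} {y} x≈y = mk≈ λ ε ε>0 →
    let N , x~y = close x≈y ε ε>0
    in N , λ n N≤n → subst (ℚ._< ε) (∣-∣-comm (seq x n) (seq y n)) (x~y n N≤n)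

  ≈-trans : ∀ {x y z} → x ≈ y → y ≈ z → x ≈ z
  ≈-trans {x} {y} {z} x≈y y≈z = mk≈ λ ε ε>0 →
    let M , x~y = close x≈y (½ ℚ.* ε) (half>0 ε>0)
        N , y~z = close y≈z (½ ℚ.* ε) (half>0 ε>0)
    in M ℕ.⊔ N , λ n M⊔N≤n →
       split {p = seq x n ℚ.- seq y n} {q = seq y n ℚ.- seq z n} _
         (eq (seq x n) (seq y n) (seq z n))
         (x~y n (ℕ.m⊔n≤o⇒m≤o M N M⊔N≤n)) (y~z n (ℕ.m⊔n≤o⇒n≤o M N M⊔N≤n))
    where
    open +-*-Solver
    eq : ∀ p q r → p ℚ.- r ≡ (p ℚ.- q) ℚ.+ (q ℚ.- r)
    eq = solve 3 (λ p q r → p :- r := (p :- q) :+ (q :- r)) refl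

  const-cauchy : ∀ q → Cauchy (λ _ → q)
  const-cauchy q ε ε>0 = 0 , λ _ _ _ _ → ∣p-p∣<ε q ε>0

  +-cauchy : ∀ {a b} → Cauchy a → Cauchy b → Cauchy (λ n → a n ℚ.+ b n)
  +-cauchy {a} {b} a-cauchy b-cauchy ε ε>0 =
    let M , close-a = a-cauchy (½ ℚ.* ε) (half>0 ε>0)
        N , close-b = b-cauchy (½ ℚ.* ε) (half>0 ε>0)
    in M ℕ.⊔ N , λ m n ≤m ≤n →
       split {p = a m ℚ.- a n} {q = b m ℚ.- b n} _ (eq (a m) (b m) (a n) (b n))
         (close-a m n (ℕ.m⊔n≤o⇒m≤o M N ≤m) (ℕ.m⊔n≤o⇒m≤o M N ≤n))
         (close-b m n (ℕ.m⊔n≤o⇒n≤o M N ≤m) (ℕ.m⊔n≤o⇒n≤o M N ≤n))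
    where
    open +-*-Solver
    eq : ∀ p q r s → (p ℚ.+ q) ℚ.- (r ℚ.+ s) ≡ (p ℚ.- r) ℚ.+ (q ℚ.- s)
    eq = solve 4 (λ p q r s → (p :+ q) :- (r :+ s) := (p :- r) :+ (q :- s)) refl

  neg-cauchy : ∀ {a} → Cauchy a → Cauchy (λ n → ℚ.- a n)
  neg-cauchy {a} a-cauchy ε ε>0 =
    let N , close-a = a-cauchy ε ε>0
    in N , λ m n ≤m ≤n →
       subst (λ r → ∣ r ∣ ℚ.< ε) (eq (a m) (a n)) (close-a n m ≤n ≤m)
    where
    open +-*-Solver
    eq : ∀ p q → q ℚ.- p ≡ (ℚ.- p) ℚ.- (ℚ.- q)
    eq = solve 2 (λ p q → q :- p := (:- p) :- (:- q)) refl

  bounded : ∀ {a} → Cauchy a → ∃[ B ] (0ℚ ℚ.< B × Eventually (λ n → ∣ a n ∣ ℚ.< B))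
  bounded {a} a-cauchy with a-cauchy 1ℚ (ℚ.positive⁻¹ 1ℚ)
  ... | N , close = ∣ a N ∣ ℚ.+ 1ℚ
                  , ℚ.+-mono-≤-< (ℚ.0≤∣p∣ (a N)) (ℚ.positive⁻¹ 1ℚ)
                  , N , λ n N≤n →
    ℚ.≤-<-trans
      (subst (λ r → ∣ r ∣ ℚ.≤ ∣ a N ∣ ℚ.+ ∣ a n ℚ.- a N ∣) (eq (a n) (a N))
        (ℚ.∣p+q∣≤∣p∣+∣q∣ (a N) (a n ℚ.- a N)))
      (ℚ.+-monoʳ-< ∣ a N ∣ (close n N N≤n ℕ.≤-refl))
    where
    open +-*-Solver
    eq : ∀ p q → q ℚ.+ (p ℚ.- q) ≡ p
    eq = solve 2 (λ p q → q :+ (p :- q) := p) refl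

  private
    -- A tolerance δ with ∣p∣ < B and ∣q∣ < δ implying ∣p q∣ < ε.
    tolerance : ∀ {ε B} → 0ℚ ℚ.< ε → 0ℚ ℚ.< B →
                ∃[ δ ] (0ℚ ℚ.< δ × (∀ p q → ∣ p ∣ ℚ.< B → ∣ q ∣ ℚ.< δ → ∣ p ℚ.* q ∣ ℚ.< ε))
    tolerance {ε} {B} ε>0 B>0 = δ , ℚ.positive⁻¹ δ , small
      where
      instance
        B⁺ : ℚ.Positive B
        B⁺ = ℚ.positive B>0
        B≢0 : ℚ.NonZero B
        B≢0 = ℚ.pos⇒nonZero B
        ε⁺ : ℚ.Positive ε
        ε⁺ = ℚ.positive ε>0
        1/B⁺ : ℚ.Positive (ℚ.1/ B)
        1/B⁺ = ℚ.1/pos⇒pos B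
      δ : ℚ
      δ = ℚ.1/ B ℚ.* ε
      instance
        δ⁺ : ℚ.Positive δ
        δ⁺ = ℚ.pos*pos⇒pos (ℚ.1/ B) ε
      Bδ≡ε : B ℚ.* δ ≡ ε
      Bδ≡ε = trans (sym (ℚ.*-assoc B (ℚ.1/ B) ε))
               (trans (cong (ℚ._* ε) (ℚ.*-inverseʳ B)) (ℚ.*-identityˡ ε))
      small : ∀ p q → ∣ p ∣ ℚ.< B → ∣ q ∣ ℚ.< δ → ∣ p ℚ.* q ∣ ℚ.< ε
      small p q p<B q<δ = begin-strict
        ∣ p ℚ.* q ∣        ≡⟨ ℚ.∣p*q∣≡∣p∣*∣q∣ p q ⟩
        ∣ p ∣ ℚ.* ∣ q ∣    ≤⟨ ℚ.*-monoʳ-≤-nonNeg ∣ q ∣ {{ℚ.nonNegative (ℚ.0≤∣p∣ q)}} (ℚ.<⇒≤ p<B) ⟩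
        B ℚ.* ∣ q ∣        <⟨ ℚ.*-monoʳ-<-pos B q<δ ⟩
        B ℚ.* δ            ≡⟨ Bδ≡ε ⟩
        ε                  ∎
        where open ℚ.≤-Reasoning

    product-close : ∀ {ε A B δ η} →
      (∀ p q → ∣ p ∣ ℚ.< A → ∣ q ∣ ℚ.< δ → ∣ p ℚ.* q ∣ ℚ.< ½ ℚ.* ε) →
      (∀ p q → ∣ p ∣ ℚ.< B → ∣ q ∣ ℚ.< η → ∣ p ℚ.* q ∣ ℚ.< ½ ℚ.* ε) →
      ∀ a b c d → ∣ a ∣ ℚ.< A → ∣ d ∣ ℚ.< B →
      ∣ b ℚ.- d ∣ ℚ.< δ → ∣ a ℚ.- c ∣ ℚ.< η →
      ∣ a ℚ.* b ℚ.- c ℚ.* d ∣ ℚ.< ε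
    product-close small₁ small₂ a b c d a<A d<B b-d<δ a-c<η =
      split {p = a ℚ.* (b ℚ.- d)} {q = d ℚ.* (a ℚ.- c)} _ (eq a b c d)
        (small₁ a (b ℚ.- d) a<A b-d<δ) (small₂ d (a ℚ.- c) d<B a-c<η)
      where
      open +-*-Solver
      eq : ∀ a b c d → a ℚ.* b ℚ.- c ℚ.* d ≡ a ℚ.* (b ℚ.- d) ℚ.+ d ℚ.* (a ℚ.- c)
      eq = solve 4 (λ a b c d → a :* b :- c :* d := a :* (b :- d) :+ d :* (a :- c)) refl

    bounds : ∀ K L M N {k} → (K ℕ.⊔ L) ℕ.⊔ (M ℕ.⊔ N) ℕ.≤ k →
             K ℕ.≤ k × L ℕ.≤ k × M ℕ.≤ k × N ℕ.≤ k
    bounds K L M N le =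
      let le₁ = ℕ.m⊔n≤o⇒m≤o (K ℕ.⊔ L) (M ℕ.⊔ N) le
          le₂ = ℕ.m⊔n≤o⇒n≤o (K ℕ.⊔ L) (M ℕ.⊔ N) le
      in ℕ.m⊔n≤o⇒m≤o K L le₁ , ℕ.m⊔n≤o⇒n≤o K L le₁ ,
         ℕ.m⊔n≤o⇒m≤o M N le₂ , ℕ.m⊔n≤o⇒n≤o M N le₂

  *-cauchy : ∀ {a b} → Cauchy a → Cauchy b → Cauchy (λ n → a n ℚ.* b n)
  *-cauchy {a} {b} a-cauchy b-cauchy ε ε>0 =
    let A , A>0 , K , a<A = bounded a-cauchy
        B , B>0 , L , b<B = bounded b-cauchy
        δ , δ>0 , small₁  = tolerance (half>0 ε>0) A>0
        η , η>0 , small₂  = tolerance (half>0 ε>0) B>0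
        M , close-a       = a-cauchy η η>0
        N , close-b       = b-cauchy δ δ>0
    in (K ℕ.⊔ L) ℕ.⊔ (M ℕ.⊔ N) , λ m n ≤m ≤n →
    let K≤m , _   , M≤m , N≤m = bounds K L M N ≤m
        _   , L≤n , M≤n , N≤n = bounds K L M N ≤n
    in product-close small₁ small₂ (a m) (b m) (a n) (b n)
         (a<A m K≤m) (b<B n L≤n) (close-b m n N≤m N≤n) (close-a m n M≤m M≤n)

ℝ-setoid : Setoid 0ℓ 0ℓ
ℝ-setoid = record
  { Carrier       = ℝ
  ; _≈_           = _≈_
  ; isEquivalence = record { refl = ≈-refl ; sym = ≈-sym ; trans = ≈-trans }
  }

fromℚ : ℚ → ℝ
fromℚ q = mkℝ (λ _ → q) (const-cauchy q)

0ℝ 1ℝ 2ℝ : ℝ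
0ℝ = fromℚ 0ℚ
1ℝ = fromℚ 1ℚ
2ℝ = fromℚ (1ℚ ℚ.+ 1ℚ)

infixl 6 _+_ _-_
infixl 7 _*_
infix  8 -_

_+_ : ℝ → ℝ → ℝ
x + y = mkℝ (λ n → seq x n ℚ.+ seq y n) (+-cauchy {seq x} {seq y} (cauchy x) (cauchy y))

-_ : ℝ → ℝ
- x = mkℝ (λ n → ℚ.- seq x n) (neg-cauchy {seq x} (cauchy x))

_-_ : ℝ → ℝ → ℝ
x - y = x + (- y)

_*_ : ℝ → ℝ → ℝ
x * y = mkℝ (λ n → seq x n ℚ.* seq y n) (*-cauchy {seq x} {seq y} (cauchy x) (cauchy y))

------------------------------------------------------------------------
-- Positive integers

record ℕ⁺ : Set where
  constructor mkℕ⁺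
  field
    val        : ℕ
    .{{val≢0}} : NonZero val

open ℕ⁺ public

infixl 7 _*⁺_

_*⁺_ : ℕ⁺ → ℕ⁺ → ℕ⁺
x *⁺ y = mkℕ⁺ (val x ℕ.* val y) {{ℕ.m*n≢0 (val x) (val y)}}

gcd⁺ : ℤ → ℕ⁺ → ℕ⁺
gcd⁺ x n = mkℕ⁺ (gcd ℤ.∣ x ∣ (val n))
  {{ℕ.≢-nonZero (gcd[m,n]≢0 ℤ.∣ x ∣ (val n) (inj₂ (ℕ.≢-nonZero⁻¹ (val n))))}}

D : ℕ⁺ → Pred ℕ⁺ 0ℓ
D n x = val x ∣ val n

P* : ℕ⁺ → Pred ℕ⁺ 0ℓ
P* n x = (∃[ p ] ∃[ i ] (Prime p × 1 ℕ.≤ i × val x ≡ p ℕ.^ i)) × val x ∣ val n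

------------------------------------------------------------------------
-- Multiplicative functions

record Multiplicative (h : ℕ⁺ → ℝ) : Set where
  field
    not-identically-zero : ¬ (∀ x → h x ≈ 0ℝ)
    multiplicative       : ∀ x y → Coprime (val x) (val y) → h (x *⁺ y) ≈ h x * h y

record 𝓘 (h : ℕ⁺ → ℝ) : Set where
  field
    isMultiplicative : Multiplicative h
    0≤h              : ∀ x → 1 ℕ.< val x → 0ℝ ≤ h x
    h≤1              : ∀ x → 1 ℕ.< val x → h x ≤ 1ℝ

------------------------------------------------------------------------
-- Sets of reals and their permutations

image : (ℕ⁺ → ℝ) → Pred ℕ⁺ 0ℓ → Pred ℝ 0ℓ
image h A r = ∃[ x ] (A x × r ≈ h x)

image-∋ : ∀ (h : ℕ⁺ → ℝ) (A : Pred ℕ⁺ 0ℓ) x → A x → image h A (h x)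
image-∋ h A x x∈A = x , x∈A , ≈-refl

image-P*⊆image-D : ∀ h n → image h (P* n) ⊆ image h (D n)
image-P*⊆image-D h n (x , x∈P* , r≈hx) = x , proj₂ x∈P* , r≈hx

-- Elements of a set of reals are compared by their values only, so a
-- permutation does not depend on the membership proofs.
subsetoid : Pred ℝ 0ℓ → Setoid 0ℓ 0ℓ
subsetoid S = On.setoid {B = ∃ S} ℝ-setoid proj₁

Permutation : Pred ℝ 0ℓ → Set
Permutation S = Bijection (subsetoid S) (subsetoid S)

apply : {S : Pred ℝ 0ℓ} → Permutation S → ∀ r → S r → ℝ
apply ν r r∈S = proj₁ (Bijection.to ν (r , r∈S))

RestrictsToPermutation : {S T : Pred ℝ 0ℓ} → T ⊆ S → Permutation S → Set
RestrictsToPermutation {S} {T} T⊆S ν =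
  Σ[ ρ ∈ Permutation T ] (∀ r (r∈T : T r) → apply ν r (T⊆S r∈T) ≈ apply ρ r r∈T)

------------------------------------------------------------------------
-- Distances on ℤ, the induced preorders, and quotients

d⁺ : ℕ⁺ → (ℕ⁺ → ℝ) → ℤ → ℤ → ℝ
d⁺ n h x y =
  if does (x ℤ.≟ y) then 0ℝ else 2ℝ - h (gcd⁺ x n) - h (gcd⁺ y n)

Preceq : (ℤ → ℤ → ℝ) → Rel ℤ 0ℓ
Preceq d x y = d 1ℤ x ≤ d 1ℤ y

Sim : (ℤ → ℤ → ℝ) → Rel ℤ 0ℓ
Sim d x y = Preceq d x y × Preceq d y x

-- The quotient as a set of equivalence classes: C belongs to ℤ/ R exactly
-- when C is, as a subset of ℤ, the class of some x.  Equality of two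
-- quotients is then equality _≐_ of sets of subsets of ℤ.
ℤ/_ : Rel ℤ 0ℓ → Pred (Pred ℤ 0ℓ) 0ℓ
(ℤ/ R) C = ∃[ x ] (C ≐ R x)

{-# OPTIONS --safe #-}
module Submission where

-- For every x, including x = 1, d(1, x) = 1 - h(gcd(x, n)), since h(1) = 1.
-- Hence x ~ y means h(gcd(x, n)) = h(gcd(y, n)), and these equalities are
-- preserved and reflected by the injection ν.

open import Defs
open import Data.Nat.Base using (_<_)
open import Relation.Unary using (_≐_)
open import Data.Product.Base using (Σ-syntax; _×_)
open import Data.Empty using (⊥-elim)
open import Data.Integer.Base as ℤ using (ℤ; 1ℤ)
import Data.Integer.Properties as ℤ
open import Data.Nat.Base as ℕ using (ℕ)
open import Data.Nat.Coprimality using (1-coprimeTo)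
open import Data.Nat.GCD using (gcd[m,n]∣n; gcd-zeroˡ)
import Data.Nat.Properties as ℕ
open import Data.Product.Base using (_,_; map₂)
open import Data.Rational.Base as ℚ using (ℚ; 0ℚ; 1ℚ; ½; ∣_∣)
import Data.Rational.Properties as ℚ
open import Data.Rational.Solver using (module +-*-Solver)
open import Data.Sum.Base using (_⊎_; inj₁; inj₂)
open import Function.Bundles using (_⇔_; mk⇔; Equivalence; Bijection)
open import Level using (0ℓ)
open import Relation.Binary.Core using (Rel)
open import Relation.Binary.PropositionalEquality
  using (_≡_; refl; sym; trans; cong; subst)
open import Relation.Nullary using (yes; no)

-- Seen from 1, the distance to x is the constant 2 - h(gcd(1, n)) minus h(gcd(x, n)), so `Sim`
-- amounts to equality of the values h(gcd(x, n)) (`Sim⇔`). At x = 1, where the distance is 0 by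
-- definition, this needs h(1) = 1. With e = h(1), a rational approximation of e shows that 1 - e or
-- e stays away from 0 (`bounded-apart`), and that factor is cancelled (`cancel-factor`). As gcd(x,
-- n) divides n, `ν` carries the values of h₁ to those of h₂: its congruence gives one implication
-- between the two relations, its injectivity the other.

p-q<ε : ∀ p q {ε} → p ℚ.< q ℚ.+ ε → p ℚ.- q ℚ.< ε
p-q<ε p q {ε} p<q+ε =
  subst (p ℚ.- q ℚ.<_) (solve 2 (λ q ε → (q :+ ε) :- q := ε) refl q ε)
    (ℚ.+-monoˡ-< (ℚ.- q) p<q+ε)
  where open +-*-Solver

neg-minus : ∀ p q → ℚ.- (p ℚ.- q) ≡ q ℚ.- p
neg-minus = solve 2 (λ p q → :- (p :- q) := q :- p) refl
  where open +-*-Solver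

∣p-q∣<ε : ∀ p q {ε} → p ℚ.< q ℚ.+ ε → q ℚ.< p ℚ.+ ε → ∣ p ℚ.- q ∣ ℚ.< ε
∣p-q∣<ε p q p<q+ε q<p+ε with ℚ.∣p∣≡p∨∣p∣≡-p (p ℚ.- q)
... | inj₁ eq = subst (ℚ._< _) (sym eq) (p-q<ε p q p<q+ε)
... | inj₂ eq = subst (ℚ._< _) (sym (trans eq (neg-minus p q))) (p-q<ε q p q<p+ε)

p≤∣p∣ : ∀ p → p ℚ.≤ ∣ p ∣
p≤∣p∣ p with ℚ.≤-total 0ℚ p
... | inj₁ 0≤p = ℚ.≤-reflexive (sym (ℚ.0≤p⇒∣p∣≡p 0≤p))
... | inj₂ p≤0 = ℚ.≤-trans p≤0 (ℚ.0≤∣p∣ p)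

p<q+ε : ∀ p q {ε} → ∣ p ℚ.- q ∣ ℚ.< ε → p ℚ.< q ℚ.+ ε
p<q+ε p q ∣p-q∣<ε =
  subst (ℚ._< _) (solve 2 (λ p q → q :+ (p :- q) := p) refl p q)
    (ℚ.+-monoʳ-< q (ℚ.≤-<-trans (p≤∣p∣ (p ℚ.- q)) ∣p-q∣<ε))
  where open +-*-Solver

Eventually-map : ∀ {P Q : ℕ → Set} → (∀ n → P n → Q n) → Eventually P → Eventually Q
Eventually-map f (N , p) = N , λ n N≤n → f n (p n N≤n)

Eventually-zip : ∀ {P Q R : ℕ → Set} → (∀ n → P n → Q n → R n) →
                 Eventually P → Eventually Q → Eventually R
Eventually-zip f (M , p) (N , q) = M ℕ.⊔ N , λ n le →
  f n (p n (ℕ.m⊔n≤o⇒m≤o M N le)) (q n (ℕ.m⊔n≤o⇒n≤o M N le))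

≤-antisym : ∀ {x y} → x ≤ y → y ≤ x → x ≈ y
≤-antisym x≤y y≤x = mk≈ λ ε ε>0 →
  Eventually-zip (λ n → ∣p-q∣<ε _ _) (below x≤y ε ε>0) (below y≤x ε ε>0)

≤-reflexive : ∀ {x y} → x ≈ y → x ≤ y
≤-reflexive x≈y = mk≤ λ ε ε>0 → Eventually-map (λ n → p<q+ε _ _) (close x≈y ε ε>0)

pointwise : ∀ {x y} → (∀ n → seq x n ≡ seq y n) → x ≈ y
pointwise {x} {y} x≡y = mk≈ λ ε ε>0 →
  Eventually-map (λ n → subst (λ q → ∣ seq x n ℚ.- q ∣ ℚ.< ε) (x≡y n)) (close (≈-refl {x}) ε ε>0)

reflection-isometry : ∀ c p q → ∣ (c ℚ.- p) ℚ.- (c ℚ.- q) ∣ ≡ ∣ p ℚ.- q ∣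
reflection-isometry c p q = trans
  (cong ∣_∣ (solve 3 (λ c p q → (c :- p) :- (c :- q) := :- (p :- q)) refl c p q))
  (ℚ.∣-p∣≡∣p∣ (p ℚ.- q))
  where open +-*-Solver

-ˡ-cong : ∀ c {x y} → x ≈ y → c - x ≈ c - y
-ˡ-cong c {x} {y} x≈y = mk≈ λ ε ε>0 → Eventually-map
  (λ n → subst (ℚ._< ε) (sym (reflection-isometry (seq c n) (seq x n) (seq y n))))
  (close x≈y ε ε>0)

-ˡ-cancel : ∀ c {x y} → c - x ≈ c - y → x ≈ y
-ˡ-cancel c {x} {y} c-x≈c-y = mk≈ λ ε ε>0 → Eventually-map
  (λ n → subst (ℚ._< ε) (reflection-isometry (seq c n) (seq x n) (seq y n)))
  (close c-x≈c-y ε ε>0)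

¼ : ℚ
¼ = ½ ℚ.* ½

∣q∣<ε : ∀ p q {ε} → ¼ ℚ.≤ ∣ p ∣ → ∣ p ℚ.* q ∣ ℚ.< ¼ ℚ.* ε → ∣ q ∣ ℚ.< ε
∣q∣<ε p q {ε} ¼≤∣p∣ ∣pq∣<¼ε = ℚ.*-cancelˡ-<-nonNeg ¼ (begin-strict
  ¼ ℚ.* ∣ q ∣      ≤⟨ ℚ.*-monoʳ-≤-nonNeg ∣ q ∣ {{ℚ.nonNegative (ℚ.0≤∣p∣ q)}} ¼≤∣p∣ ⟩
  ∣ p ∣ ℚ.* ∣ q ∣  ≡⟨ ℚ.∣p*q∣≡∣p∣*∣q∣ p q ⟨
  ∣ p ℚ.* q ∣      <⟨ ∣pq∣<¼ε ⟩
  ¼ ℚ.* ε          ∎)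
  where open ℚ.≤-Reasoning

-- Dividing by a factor of absolute value at least ¼ enlarges an error at most fourfold, hence the
-- tolerance ¼ε. Working termwise avoids forming an inverse in `ℝ`.
cancel-factor : ∀ (c : ℕ → ℚ) {u v x y} → Eventually (λ n → ¼ ℚ.≤ ∣ c n ∣) →
                (∀ n → seq u n ℚ.- seq v n ≡ c n ℚ.* (seq x n ℚ.- seq y n)) →
                u ≈ v → x ≈ y
cancel-factor c {u} {v} ¼≤∣c∣ u-v≡c[x-y] u≈v = mk≈ λ ε ε>0 →
  Eventually-zip
    (λ n ¼≤∣cn∣ small → ∣q∣<ε (c n) _ ¼≤∣cn∣
      (subst (λ r → ∣ r ∣ ℚ.< ¼ ℚ.* ε) (u-v≡c[x-y] n) small))
    ¼≤∣c∣
    (close u≈v (¼ ℚ.* ε) (ℚ.positive⁻¹ _ {{ℚ.pos*pos⇒pos ¼ ε {{ℚ.positive ε>0}}}}))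

-- Past the index `N` all terms differ by less than ¼. If term `N` is at most ½, later ones stay
-- below ¾; otherwise they exceed ¼. Only rationals are compared, so no equality of reals has to be
-- decided.
bounded-apart : ∀ x → Eventually (λ n → ¼ ℚ.≤ ∣ 1ℚ ℚ.- seq x n ∣)
                    ⊎ Eventually (λ n → ¼ ℚ.≤ ∣ seq x n ∣)
bounded-apart x with cauchy x ¼ (ℚ.positive⁻¹ ¼)
... | N , near with ℚ.≤-total (seq x N) ½
...   | inj₁ xN≤½ = inj₁ (N , λ n N≤n → ℚ.≤-trans
        (ℚ.+-monoʳ-≤ 1ℚ (ℚ.neg-antimono-≤
          (ℚ.≤-trans (ℚ.<⇒≤ (p<q+ε (seq x n) (seq x N) (near n N N≤n ℕ.≤-refl)))
                     (ℚ.+-monoˡ-≤ ¼ xN≤½))))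
        (p≤∣p∣ (1ℚ ℚ.- seq x n)))
...   | inj₂ ½≤xN = inj₂ (N , λ n N≤n → ℚ.≤-trans
        (ℚ.<⇒≤ (p-q<ε ½ ¼ (subst (½ ℚ.<_) (ℚ.+-comm (seq x n) ¼)
          (ℚ.≤-<-trans ½≤xN (p<q+ε (seq x N) (seq x n) (near N n ℕ.≤-refl N≤n))))))
        (p≤∣p∣ (seq x n)))

val-injective : ∀ {x y} → val x ≡ val y → x ≡ y
val-injective {mkℕ⁺ _} {mkℕ⁺ _} refl = refl

1⁺ : ℕ⁺
1⁺ = mkℕ⁺ 1

-- h(1) is an idempotent, hence 0 or 1, and h(1) = 0 would force h = 0.
h[1]≈1 : ∀ {h} → Multiplicative h → h 1⁺ ≈ 1ℝ
h[1]≈1 {h} mult with bounded-apart (h 1⁺)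
... | inj₁ 1-h1-apart = ⊥-elim (not-identically-zero λ x →
        cancel-factor (λ n → 1ℚ ℚ.- seq (h 1⁺) n) 1-h1-apart
          (λ n → solve 2 (λ e p → p :- e :* p := (con 1ℚ :- e) :* (p :- con 0ℚ)) refl
                   (seq (h 1⁺) n) (seq (h x) n))
          (h≈h[1]h x))
  where
  open Multiplicative mult
  open +-*-Solver
  h≈h[1]h : ∀ x → h x ≈ h 1⁺ * h x
  h≈h[1]h x = subst (λ y → h y ≈ h 1⁺ * h x) (val-injective (ℕ.*-identityˡ (val x)))
                (multiplicative 1⁺ x (1-coprimeTo (val x)))
... | inj₂ h1-apart = ≈-sym
        (cancel-factor (seq (h 1⁺)) h1-apart
          (λ n → solve 1 (λ e → e :- e :* e := e :* (con 1ℚ :- e)) refl (seq (h 1⁺) n))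
          -- `1⁺ *⁺ 1⁺` computes to `1⁺`, so this is e ≈ e * e.
          (multiplicative 1⁺ 1⁺ (1-coprimeTo 1)))
  where
  open Multiplicative mult
  open +-*-Solver

-- At x = 1 this holds because 2 - h(1) - h(1) = 0.
d⁺-from-1 : ∀ n {h} → Multiplicative h → ∀ x →
            d⁺ n h 1ℤ x ≈ 2ℝ - h (gcd⁺ 1ℤ n) - h (gcd⁺ x n)
d⁺-from-1 n {h} mult x with 1ℤ ℤ.≟ x
... | no _ = ≈-refl
... | yes refl =
  -- Each 1 is brought into the subtracted position before being replaced by `a`, because `-ˡ-cong`
  -- rewrites only there.
  ≈-trans (pointwise {0ℝ} {1ℝ - 1ℝ} (λ _ → refl))
    (≈-trans (-ˡ-cong 1ℝ 1≈a)
      (≈-trans (pointwise {1ℝ - a} {2ℝ - a - 1ℝ} (λ n →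
                 solve 1 (λ p → con 1ℚ :- p := con (1ℚ ℚ.+ 1ℚ) :- p :- con 1ℚ) refl (seq a n)))
        (-ˡ-cong (2ℝ - a) 1≈a)))
  where
  open +-*-Solver
  a : ℝ
  a = h (gcd⁺ 1ℤ n)
  1≈a : 1ℝ ≈ a
  1≈a = subst (λ y → 1ℝ ≈ h y) (val-injective (sym (gcd-zeroˡ (val n)))) (≈-sym (h[1]≈1 mult))

-- By antisymmetry `Sim` equates the distances from 1, and their common constant cancels.
Sim⇔ : ∀ n {h} → Multiplicative h → ∀ x y →
       Sim (d⁺ n h) x y ⇔ h (gcd⁺ x n) ≈ h (gcd⁺ y n)
Sim⇔ n {h} mult x y = mk⇔
  (λ (x≼y , y≼x) → -ˡ-cancel (2ℝ - h (gcd⁺ 1ℤ n))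
    (≈-trans (≈-sym (dist x)) (≈-trans (≤-antisym x≼y y≼x) (dist y))))
  (λ hx≈hy → let dx≈dy = ≈-trans (dist x) (≈-trans (-ˡ-cong _ hx≈hy) (≈-sym (dist y)))
             in ≤-reflexive dx≈dy , ≤-reflexive (≈-sym dx≈dy))
  where
  dist : ∀ z → d⁺ n h 1ℤ z ≈ 2ℝ - h (gcd⁺ 1ℤ n) - h (gcd⁺ z n)
  dist = d⁺-from-1 n mult

-- The same representative serves for both relations, so `map₂` leaves it fixed.
ℤ/-cong : ∀ {R S : Rel ℤ 0ℓ} → (∀ x y → R x y ⇔ S x y) → (ℤ/ R) ≐ (ℤ/ S)
ℤ/-cong R⇔S =
  map₂ (λ {x} (C⊆ , ⊆C) → (λ c → to (R⇔S x _) (C⊆ c)) , (λ s → ⊆C (from (R⇔S x _) s))) ,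
  map₂ (λ {x} (C⊆ , ⊆C) → (λ c → from (R⇔S x _) (C⊆ c)) , (λ r → ⊆C (to (R⇔S x _) r)))
  where open Equivalence

proposition4p7 : (n : ℕ⁺) → 1 < val n → (h₁ h₂ : ℕ⁺ → ℝ) → 𝓘 h₁ → 𝓘 h₂ →
    Σ[ ν ∈ Permutation (image h₁ (D n)) ]
    ( RestrictsToPermutation (image-P*⊆image-D h₁ n) ν
    × (∀ x (x∈D : D n x) → h₂ x ≈ apply ν (h₁ x) (image-∋ h₁ (D n) x x∈D)) ) →
    (ℤ/ Sim (d⁺ n h₁)) ≐ (ℤ/ Sim (d⁺ n h₂))
proposition4p7 n _ h₁ h₂ h₁∈𝓘 h₂∈𝓘 (ν , _ , h₂≈νh₁) = ℤ/-cong λ x y → mk⇔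
  (λ s → from (sim₂ x y) (h₁⇒h₂ x y (to (sim₁ x y) s)))
  (λ s → from (sim₁ x y) (h₂⇒h₁ x y (to (sim₂ x y) s)))
  where
  open Equivalence using (to; from)

  sim₁ : ∀ x y → Sim (d⁺ n h₁) x y ⇔ h₁ (gcd⁺ x n) ≈ h₁ (gcd⁺ y n)
  sim₁ = Sim⇔ n (𝓘.isMultiplicative h₁∈𝓘)

  sim₂ : ∀ x y → Sim (d⁺ n h₂) x y ⇔ h₂ (gcd⁺ x n) ≈ h₂ (gcd⁺ y n)
  sim₂ = Sim⇔ n (𝓘.isMultiplicative h₂∈𝓘)

  gcd∈D : ∀ x → D n (gcd⁺ x n)
  gcd∈D x = gcd[m,n]∣n ℤ.∣ x ∣ (val n)

  h₂≈ν : ∀ x → h₂ (gcd⁺ x n) ≈ apply ν (h₁ (gcd⁺ x n)) (image-∋ h₁ (D n) _ (gcd∈D x))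
  h₂≈ν x = h₂≈νh₁ (gcd⁺ x n) (gcd∈D x)

  h₁⇒h₂ : ∀ x y → h₁ (gcd⁺ x n) ≈ h₁ (gcd⁺ y n) → h₂ (gcd⁺ x n) ≈ h₂ (gcd⁺ y n)
  -- The subsetoid compares values only, so the two membership witnesses may differ.
  h₁⇒h₂ x y eq = ≈-trans (h₂≈ν x) (≈-trans (Bijection.cong ν eq) (≈-sym (h₂≈ν y)))

  h₂⇒h₁ : ∀ x y → h₂ (gcd⁺ x n) ≈ h₂ (gcd⁺ y n) → h₁ (gcd⁺ x n) ≈ h₁ (gcd⁺ y n)
  h₂⇒h₁ x y eq = Bijection.injective ν
    (≈-trans (≈-sym (h₂≈ν x)) (≈-trans eq (h₂≈ν y)))
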